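{- (Parallel composition rule.) Fix a model with finite thread set $\mathit{Tid}$, and for each thread $A\in\mathit{Tid}$ let $G_A^{\mathsf{step}}$ and $R_A^{\mathsf{step}}$ be formulas expressing predicates over the current and the previous state, with associated guarantee $\mathsf{G}_A:=\mathbf{Always}(\mathsf{after}_A\rightarrow G_A^{\mathsf{step}})$ and rely $\mathsf{R}_A:=\mathbf{Always}(\neg\mathsf{after}_A\rightarrow R_A^{\mathsf{step}})$. Write $\mathsf{G}_{ -A}:=\bigwedge_{B\in\mathit{Tid}\setminus\{A\}}\mathsf{G}_B$. Let $I$ be any formula (invariant candidate). Suppose that 1. for every $A\in\mathit{Tid}$, $\ \mathsf{G}_{ -A}\models\mathsf{R}_A$; and 2. for every $A\in\mathit{Tid}$, $\ \mathsf{G}_A\wedge\mathsf{R}_A\models\mathsf{Pres}_A(I)$. Then $$\Bigl(\bigwedge_{A\in\mathit{Tid}}\mathsf{G}_A\Bigr)\models\mathsf{Pres}(I).$$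
   Context: **Program model.** $\mathit{Tid}=\{1,\dots,n\}$ is a finite set of threads. A global state $s$ consists of a shared store $s.\sigma$ (a map from shared variables to values) and, for each thread $A$, a local component $s.\lambda_A$ (control location and local variables). There is a labelled transition relation $s\xrightarrow{A}s'$ ($A\in\mathit{Tid}$) satisfying locality: if $s\xrightarrow{A}s'$ then $s'.\lambda_B=s.\lambda_B$ for all $B\neq A$. A run is an infinite sequence $\pi=s_0s_1s_2\cdots$ such that for each $i\ge 0$ there is a unique thread $\mathsf{act}(i)$ (depending on $\pi$) with $s_i\xrightarrow{\mathsf{act}(i)}s_{i+1}$. A point is a pair $(\pi,i)$, $i\ge 0$. **Indistinguishability.** $\mathsf{obs}_A(s)=s.\lambda_A$. If $k_1<\cdots<k_m$ are the indices $k<i$ with $\mathsf{act}(k)=A$, then $\mathsf{Hist}_A(\pi,i)=\langle \mathsf{obs}_A(s_0),\mathsf{obs}_A(s_{k_1+1}),\dots,\mathsf{obs}_A(s_{k_m+1}),\mathsf{obs}_A(s_i)\rangle$. Put $(\pi,i)\sim_A(\pi',i')$ iff $\mathsf{Hist}_A(\pi,i)=\mathsf{Hist}_A(\pi',i')$. A model is a set of runs together with the relations $\sim_A$: by default all runs of the transition system; if an interface specification (a conjunction of $\mathbf{Always}$-guarded step constraints) is fixed, all runs satisfying it. **Logic.** Formulas: $\phi,\psi ::= p \mid A\ \mathsf{act}\mid\neg\phi\mid\phi\wedge\psi\mid\mathbf{Prev}\,\phi\mid\phi\,\mathbf{Since}\,\psi\mid\mathbf{K}_A\phi$, with $p$ atomic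 predicates of global states; $\vee,\rightarrow,\top$ are abbreviations. Semantics: $(\pi,i)\models p$ iff $p$ holds of $s_i$; $(\pi,i)\models A\ \mathsf{act}$ iff $\mathsf{act}(i)=A$; Booleans as usual; $(\pi,i)\models\mathbf{Prev}\,\phi$ iff $i>0$ and $(\pi,i-1)\models\phi$; $(\pi,i)\models\phi\,\mathbf{Since}\,\psi$ iff there is $0\le j\le i$ with $(\pi,j)\models\psi$ and $(\pi,k)\models\phi$ for all $j<k\le i$; $(\pi,i)\models\mathbf{K}_A\phi$ iff $(\pi',i')\models\phi$ for all points $(\pi',i')$ of the model with $(\pi,i)\sim_A(\pi',i')$. Entailment is relative to the fixed model: $\phi\models\psi$ means that $\psi$ holds at every point of the model at which $\phi$ holds. **Derived notions.** $\mathbf{Always}\,\phi:=\neg(\top\,\mathbf{Since}\,\neg\phi)$. $\mathsf{after}_A:=\mathbf{Prev}(A\ \mathsf{act})$. A predicate over the current and previous state is a formula in which the previous state is referred to via $\mathbf{Prev}$. $\mathsf{Pres}(I):=\mathbf{Always}\bigl(\mathbf{Prev}\,\top\rightarrow(\mathbf{Prev}\,I\rightarrow I)\bigr)$ and $\mathsf{Pres}_A(I):=\mathbf{Always}\bigl(\mathsf{after}_A\rightarrow(\mathbf{Prev}\,I\rightarrow I)\bigr)$. -}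

module Defs where

open import Data.Fin using (Fin)
open import Data.Fin.Properties using (_≟_)
open import Data.List using (List; []; _∷_; _++_; [_]; map; filter; foldr; upTo; allFin)
open import Data.Nat using (ℕ; suc; pred; _<_; _≤_)
open import Data.Product using (∃!; ∃-syntax; _×_; proj₁)
import Data.Unit as Unit
open import Level using (0ℓ)
open import Relation.Binary.PropositionalEquality using (_≡_; _≢_)
open import Relation.Nullary using (¬_)
open import Relation.Nullary.Decidable using (¬?)
open import Relation.Unary using (Pred; _∈_)

record State {n : ℕ} (Var Val : Set) (Loc : Fin n → Set) : Set where
  field
    σ   : Var → Val
    loc : (A : Fin n) → Loc A

record System (n : ℕ) : Set₁ where
  field
    Var Val : Set
    Loc     : Fin n → Set

  GlobalState : Set
  GlobalState = State Var Val Loc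

  field
    Step     : Fin n → GlobalState → GlobalState → Set
    locality : ∀ {A s s′} → Step A s s′ →
               ∀ B → B ≢ A → State.loc s′ B ≡ State.loc s B

module _ {n : ℕ} (S : System n) where
  open System S

  record Run : Set where
    field
      state  : ℕ → GlobalState
      active : ∀ i → ∃! _≡_ (λ A → Step A (state i) (state (suc i)))

    act : ℕ → Fin n
    act i = proj₁ (active i)

  -- The relations ∼ are determined by the runs, so a model is just a set of
  -- runs.  It need not be the set of all runs (e.g. when an interface
  -- specification is imposed).
  Model : Set₁
  Model = Pred Run 0ℓ

  infix  8 _actᶠ
  infix  7 ¬ᶠ_
  infixr 6 _∧ᶠ_

  data Formula : Set₁ where
    atom   : Pred GlobalState 0ℓ → Formula
    _actᶠ  : Fin n → Formula
    ¬ᶠ_    : Formula → Formula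
    _∧ᶠ_   : Formula → Formula → Formula
    Prev   : Formula → Formula
    _Since_ : Formula → Formula → Formula
    K      : Fin n → Formula → Formula

module _ {n : ℕ} {S : System n} where
  open System S
  open Run

  obs : (A : Fin n) → GlobalState → Loc A
  obs A s = State.loc s A

  Hist : (A : Fin n) → Run S → ℕ → List (Loc A)
  Hist A π i =
    obs A (state π 0)
      ∷ map (λ k → obs A (state π (suc k))) (filter (λ k → act π k ≟ A) (upTo i))
      ++ [ obs A (state π i) ]

  infix 2 _,_,_⊨_
  infix 2 _∶_⊨_
  infixr 5 _→ᶠ_

  _,_,_⊨_ : Model S → Run S → ℕ → Formula S → Set
  M , π , i ⊨ atom p    = p (state π i)
  M , π , i ⊨ A actᶠ    = act π i ≡ A
  M , π , i ⊨ ¬ᶠ φ      = ¬ (M , π , i ⊨ φ)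
  M , π , i ⊨ φ ∧ᶠ ψ    = (M , π , i ⊨ φ) × (M , π , i ⊨ ψ)
  M , π , i ⊨ Prev φ    = (0 < i) × (M , π , pred i ⊨ φ)
  M , π , i ⊨ φ Since ψ =
    ∃[ j ] (j ≤ i) × (M , π , j ⊨ ψ) × (∀ k → j < k → k ≤ i → M , π , k ⊨ φ)
  M , π , i ⊨ K A φ     =
    ∀ π′ i′ → π′ ∈ M → Hist A π i ≡ Hist A π′ i′ → M , π′ , i′ ⊨ φ

  _∶_⊨_ : Model S → Formula S → Formula S → Set
  M ∶ φ ⊨ ψ = ∀ π i → π ∈ M → M , π , i ⊨ φ → M , π , i ⊨ ψ

  _→ᶠ_ : Formula S → Formula S → Formula S
  φ →ᶠ ψ = ¬ᶠ (φ ∧ᶠ ¬ᶠ ψ)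

  -- p → p for an arbitrarily chosen atom p
  ⊤ᶠ : Formula S
  ⊤ᶠ = p →ᶠ p
    where
    p : Formula S
    p = atom (λ _ → Unit.⊤)

  ⋀ : List (Formula S) → Formula S
  ⋀ = foldr _∧ᶠ_ ⊤ᶠ

  Always : Formula S → Formula S
  Always φ = ¬ᶠ (⊤ᶠ Since (¬ᶠ φ))

  after : Fin n → Formula S
  after A = Prev (A actᶠ)

  -- LooksBack d φ: the only temporal operator in φ is Prev, nested at most
  -- d deep.  With d = 1 only the current and the previous position are
  -- inspected; act and K are not excluded.
  data LooksBack : ℕ → Formula S → Set₁ where
    atom : ∀ {d} p → LooksBack d (atom p)
    turn : ∀ {d} A → LooksBack d (A actᶠ)
    neg  : ∀ {d φ} → LooksBack d φ → LooksBack d (¬ᶠ φ)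
    and  : ∀ {d φ ψ} → LooksBack d φ → LooksBack d ψ → LooksBack d (φ ∧ᶠ ψ)
    prev : ∀ {d φ} → LooksBack d φ → LooksBack (suc d) (Prev φ)
    know : ∀ {d φ} A → LooksBack d φ → LooksBack d (K A φ)

  IsStepPredicate : Formula S → Set₁
  IsStepPredicate = LooksBack 1

  Guarantee : (Fin n → Formula S) → Fin n → Formula S
  Guarantee Gstep A = Always (after A →ᶠ Gstep A)

  Rely : (Fin n → Formula S) → Fin n → Formula S
  Rely Rstep A = Always (¬ᶠ after A →ᶠ Rstep A)

  ⋀All : (Fin n → Formula S) → Formula S
  ⋀All F = ⋀ (map F (allFin n))

  ⋀Except : Fin n → (Fin n → Formula S) → Formula S
  ⋀Except A F = ⋀ (map F (filter (λ B → ¬? (B ≟ A)) (allFin n)))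

  Pres : Formula S → Formula S
  Pres I = Always (Prev ⊤ᶠ →ᶠ (Prev I →ᶠ I))

  PresBy : Fin n → Formula S → Formula S
  PresBy A I = Always (after A →ᶠ (Prev I →ᶠ I))

{-# OPTIONS --safe #-}
-- A step to position j is taken by a single thread A = act (j − 1), so only
-- Pres_A(I) is needed there; hypothesis 1 turns the guarantees of the other
-- threads into the rely of A, and hypothesis 2 then gives Pres_A(I).
-- Implication and Always are negative formulas, so everything below is read up
-- to double negation and no excluded middle is needed.
module Submission where

open import Data.Fin using (Fin)
open import Data.Fin.Properties using (_≟_)
open import Data.List using (List; []; _∷_; map; filter; allFin)
open import Data.List.Membership.Propositional.Properties using (∈-allFin)
open import Data.List.Relation.Unary.All as All using (All; []; _∷_)
import Data.List.Relation.Unary.All.Properties as All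
open import Data.Nat using (ℕ; pred; _≤_)
open import Data.Product using (_,_)
open import Relation.Binary.PropositionalEquality using (refl)
open import Relation.Nullary using (¬_)
open import Relation.Nullary.Decidable using (¬?)
open import Defs

module _ {n : ℕ} {S : System n} (M : Model S) (π : Run S) where

  ⊤ᶠ-holds : ∀ i → M , π , i ⊨ ⊤ᶠ
  ⊤ᶠ-holds i (p , ¬p) = ¬p p

  Always-intro : ∀ φ {i} → (∀ j → j ≤ i → ¬ ¬ (M , π , j ⊨ φ)) → M , π , i ⊨ Always φ
  Always-intro φ h (j , j≤i , ¬φj , _) = h j j≤i ¬φj

  -- A refutation of `φ` at `j` would make `j` a witness of the negated `Since`, whose left argument
  -- `⊤ᶠ` holds everywhere.
  Always-elim : ∀ φ {i} → M , π , i ⊨ Always φ → ∀ j → j ≤ i → ¬ ¬ (M , π , j ⊨ φ)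
  Always-elim φ h j j≤i ¬φj = h (j , j≤i , ¬φj , λ k _ _ → ⊤ᶠ-holds k)

  ⋀-intro : ∀ {i} {φs : List (Formula S)} → All (M , π , i ⊨_) φs → M , π , i ⊨ ⋀ φs
  ⋀-intro {i} []   = ⊤ᶠ-holds i
  ⋀-intro (p ∷ ps) = p , ⋀-intro ps

  ⋀-elim : ∀ {i} (φs : List (Formula S)) → M , π , i ⊨ ⋀ φs → All (M , π , i ⊨_) φs
  ⋀-elim []       _        = []
  ⋀-elim (φ ∷ φs) (p , ps) = p ∷ ⋀-elim φs ps

  ⋀All-elim : ∀ {i} (F : Fin n → Formula S) → M , π , i ⊨ ⋀All F → ∀ A → M , π , i ⊨ F A
  ⋀All-elim F h A = All.lookup (All.map⁻ (⋀-elim (map F (allFin n)) h)) (∈-allFin A)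

  -- The premise includes `B = A`, so it covers whatever sublist the filter selects.
  ⋀Except-intro : ∀ {i} A (F : Fin n → Formula S) → (∀ B → M , π , i ⊨ F B) →
                  M , π , i ⊨ ⋀Except A F
  ⋀Except-intro A F h =
    ⋀-intro (All.map⁺ (All.universal h (filter (λ B → ¬? (B ≟ A)) (allFin n))))

  PresBy⇒Pres : ∀ I {i} → (∀ A → M , π , i ⊨ PresBy A I) → M , π , i ⊨ Pres I
  PresBy⇒Pres I presBy = Always-intro (Prev ⊤ᶠ →ᶠ (Prev I →ᶠ I)) λ where
    j j≤i ¬pres → ¬pres λ where
      ((0<j , _) , ¬step) →
        -- The step into `j` starts at `pred j`, the index that `Prev` reads; with this `A`,
        -- `after A` holds at `j` by `0<j` and `refl`. The goal is absurdity, so the double negation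
        -- from `Always-elim` can be used directly.
        let A = Run.act π (pred j)
        in Always-elim (after A →ᶠ (Prev I →ᶠ I)) (presBy A) j j≤i
             λ presA → presA ((0<j , refl) , ¬step)

mainTheorem3 : ∀ (n : ℕ) (S : System n) (M : Model S)
    (Gstep Rstep : Fin n → Formula S) →
    (∀ A → IsStepPredicate (Gstep A)) →
    (∀ A → IsStepPredicate (Rstep A)) →
    ∀ (I : Formula S) →
    (∀ A → M ∶ ⋀Except A (Guarantee Gstep) ⊨ Rely Rstep A) →
    (∀ A → M ∶ (Guarantee Gstep A ∧ᶠ Rely Rstep A) ⊨ PresBy A I) →
    M ∶ ⋀All (Guarantee Gstep) ⊨ Pres I
mainTheorem3 n S M Gstep Rstep _ _ I rely presBy π i π∈M guarantees =
  PresBy⇒Pres M π I λ A →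
    -- Both hypotheses are used at the point `i` itself; earlier positions are reached only inside
    -- `Always`.
    presBy A π i π∈M (G A , rely A π i π∈M (⋀Except-intro M π A (Guarantee Gstep) G))
  where
  G : ∀ A → M , π , i ⊨ Guarantee Gstep A
  G = ⋀All-elim M π (Guarantee Gstep) guarantees
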